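{- Let $h\geq 3$ be an integer and let $A$ be a finite set of $k\geq 3$ positive integers. If $|h_{\pm}A|=2hk-h+1$, then $A=d*\{1,3,\ldots,2k-1\}$ for some positive integer $d$.
   Context: For a finite set $A=\{a_0,a_1,\ldots,a_{k-1}\}$ of integers and a positive integer $h$, the $h$-fold signed sumset of $A$ is \[h_{\pm}A=\Big\{\sum_{i=0}^{k-1}\lambda_i a_i : (\lambda_0,\ldots,\lambda_{k-1})\in\mathbb{Z}^k,\ \sum_{i=0}^{k-1}|\lambda_i|=h\Big\}.\] For an integer $d$ and a set $B$ of integers, $d*B=\{db : b\in B\}$ denotes the $d$-dilation of $B$. -}

module Defs where

open import Data.Nat using (ℕ; zero; suc)
open import Data.Integer using (ℤ; +_; _+_; _*_; ∣_∣)
open import Data.Fin using (Fin)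
import Data.Fin as Fin
open import Data.List using (List; length; lookup)
open import Data.List.Membership.Propositional using (_∈_)
open import Data.List.Relation.Unary.Unique.Propositional using (Unique)
open import Data.Product using (Σ; ∃; _×_)
open import Function.Bundles using (_⇔_)
open import Relation.Binary.PropositionalEquality using (_≡_)

sumℤ : (n : ℕ) → (Fin n → ℤ) → ℤ
sumℤ zero    f = + 0
sumℤ (suc n) f = f Fin.zero + sumℤ n (λ i → f (Fin.suc i))

sumℕ : (n : ℕ) → (Fin n → ℕ) → ℕ
sumℕ zero    f = 0
sumℕ (suc n) f = f Fin.zero Data.Nat.+ sumℕ n (λ i → f (Fin.suc i))

-- x ∈ h_± A, where the set A = {a_0,...,a_{k-1}} is given as a duplicate-free list
InSignedSumset : ℕ → List ℤ → ℤ → Set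
InSignedSumset h A x =
  Σ (Fin (length A) → ℤ) λ c →
    (sumℕ (length A) (λ i → ∣ c i ∣) ≡ h) ×
    (sumℤ (length A) (λ i → c i * lookup A i) ≡ x)

HasCard : (ℤ → Set) → ℕ → Set
HasCard P n = Σ (List ℤ) λ L → Unique L × (∀ x → (x ∈ L) ⇔ P x) × (length L ≡ n)

{-# OPTIONS --safe #-}

-- Let a₁ < … < aₖ be the elements of A. The sums i aₜ₊₁ + (h − i) aₜ already give
-- h (k − 1) + 1 positive elements of h±A. If three consecutive elements are not in
-- arithmetic progression, these three contribute h − 1 further positive sums, and
-- counting the negatives as well gives at least 2hk elements, which is too many.
-- So A is an arithmetic progression a, a + d, …, and it suffices to exhibit h further
-- elements unless d = 2a. If d ≤ a, there are h of them strictly between −h a and h a.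
-- If d > a and d ≠ 2a, then d ∤ 2a, so the h sums −a + j (a + d) + i (a + 2d) with
-- i + j = h − 1 are positive and not congruent to h a modulo d, unlike the sums above.
module Submission where

open import Defs
open import Data.Nat using (ℕ; zero; suc; _≤_; _+_; _*_; _∸_; z≤n; s≤s)
import Data.Nat as ℕ
open import Data.Nat.Divisibility using (_∣_; divides; ∣m+n∣m⇒∣n)
open import Data.Nat.Properties
open import Data.Nat.Tactic.RingSolver using (solve-∀)
open import Data.Integer using (ℤ; +_; +<+; _<_; ∣_∣; _⊖_; -_)
import Data.Integer as ℤ
import Data.Integer.Properties as ℤ
open import Data.Integer.Tactic.RingSolver using () renaming (solve-∀ to solveℤ-∀)
import Data.Fin as Fin
open import Data.List using (List; []; _∷_; _++_; length; map)
open import Data.List.Properties using (length-++; length-map)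
open import Data.List.Membership.Propositional using (_∈_)
open import Data.List.Membership.Propositional.Properties using (∈-∃++; ∈-map⁺; ∈-map⁻)
open import Data.List.Relation.Binary.Permutation.Propositional using (_↭_; refl; prep; swap; trans; ↭-sym; ↭⇒↭ₛ)
open import Data.List.Relation.Binary.Permutation.Propositional.Properties using (shift; ∈-resp-↭; All-resp-↭; ↭-length)
import Data.List.Relation.Binary.Permutation.Setoid.Properties as SetoidPermutation
open import Data.List.Relation.Unary.Any using (here; there)
open import Data.List.Relation.Unary.Unique.Propositional using (Unique)
import Data.List.Relation.Unary.Unique.Propositional.Properties as Unique
open import Data.List.Relation.Unary.AllPairs using ([]; _∷_)
open import Data.List.Relation.Unary.All using (All; []; _∷_)
import Data.List.Relation.Unary.All as All
import Data.List.Relation.Unary.All.Properties as All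
open import Data.List.Relation.Unary.Linked using (Linked; []; [-]; _∷_)
import Data.List.Relation.Unary.Linked as Linked
open import Data.List.Relation.Unary.Linked.Properties using (AllPairs⇒Linked)
open import Data.List.Sort ≤-decTotalOrder using (sort; sort-↭; sort-↗)
open import Data.Product using (Σ; _×_; _,_; proj₁; proj₂)
open import Data.Sum using (_⊎_; inj₁; inj₂)
open import Data.Empty using (⊥)
open import Function using (_∘_)
open import Function.Bundles using (_⇔_; Equivalence; mk⇔)
open import Relation.Binary.Definitions using (tri<; tri≈; tri>)
open import Relation.Nullary using (¬_; yes; no; contradiction)
open import Relation.Binary.PropositionalEquality using (_≡_; _≢_; refl; sym; cong; cong₂; subst; subst₂; module ≡-Reasoning)
import Relation.Binary.PropositionalEquality as ≡
open SetoidPermutation (≡.setoid ℕ) using (Unique-resp-↭)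

-- Signed sums

-- Indexing by weight and value turns permuting, negating and padding with zero coefficients into
-- structural recursions. The list holds naturals because the elements of A are positive.
data SignedSum : List ℕ → ℕ → ℤ → Set where
  []  : SignedSum [] 0 (+ 0)
  _∷_ : ∀ {a l h x} (c : ℤ) → SignedSum l h x →
        SignedSum (a ∷ l) (∣ c ∣ + h) (c ℤ.* + a ℤ.+ x)

Sum⁺ : List ℕ → ℕ → ℕ → Set
Sum⁺ l h n = SignedSum l h (+ n)

signedSum⇒InSignedSumset : ∀ {l h x} → SignedSum l h x → InSignedSumset h (map +_ l) x
signedSum⇒InSignedSumset [] = (λ ()) , refl , refl
signedSum⇒InSignedSumset (c ∷ s) with f , p , q ← signedSum⇒InSignedSumset s =
  (λ { Fin.zero → c ; (Fin.suc i) → f i }) , cong₂ _+_ refl p , cong₂ ℤ._+_ (refl {x = c ℤ.* _}) q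

signedSum-resp-↭ : ∀ {l l′ h x} → l ↭ l′ → SignedSum l h x → SignedSum l′ h x
signedSum-resp-↭ refl s = s
signedSum-resp-↭ (prep a p) (c ∷ s) = c ∷ signedSum-resp-↭ p s
signedSum-resp-↭ (swap a b p) (c ∷ (d ∷ s)) =
  subst₂ (SignedSum _) (swapℕ (∣ d ∣) (∣ c ∣) _) (swapℤ (d ℤ.* + b) (c ℤ.* + a) _)
    (d ∷ (c ∷ signedSum-resp-↭ p s))
  where
  swapℕ : ∀ x y z → x + (y + z) ≡ y + (x + z)
  swapℕ = solve-∀
  swapℤ : ∀ x y z → x ℤ.+ (y ℤ.+ z) ≡ y ℤ.+ (x ℤ.+ z)
  swapℤ = solveℤ-∀
signedSum-resp-↭ (trans p q) s = signedSum-resp-↭ q (signedSum-resp-↭ p s)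

signedSum-neg : ∀ {l h x} → SignedSum l h x → SignedSum l h (- x)
signedSum-neg [] = []
signedSum-neg {a ∷ l} {h} (_∷_ {h = h′} {x = x} c s) =
  subst₂ (SignedSum _) (cong (_+ h′) (ℤ.∣-i∣≡∣i∣ c)) (distrib c (+ a) x) ((- c) ∷ signedSum-neg s)
  where
  distrib : ∀ c a x → (- c) ℤ.* a ℤ.+ (- x) ≡ - (c ℤ.* a ℤ.+ x)
  distrib = solveℤ-∀

signedSum-weaken : ∀ {a l h x} → SignedSum l h x → SignedSum (a ∷ l) h x
signedSum-weaken {a} {x = x} s =
  subst (SignedSum _ _) (≡.trans (cong (ℤ._+ x) (ℤ.*-zeroˡ (+ a))) (ℤ.+-identityˡ x)) ((+ 0) ∷ s)

signedSum-zero : ∀ l → SignedSum l 0 (+ 0)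
signedSum-zero []      = []
signedSum-zero (a ∷ l) = signedSum-weaken (signedSum-zero l)

-- Signed values are written as differences of naturals, so that identities between them can be
-- checked in ℕ by moving terms across.
⊖-cong : ∀ m n p q → m + q ≡ p + n → m ⊖ n ≡ p ⊖ q
⊖-cong m n p q eq = begin
  m ⊖ n             ≡⟨ sym (ℤ.+-cancelˡ-⊖ q m n) ⟩
  (q + m) ⊖ (q + n) ≡⟨ cong₂ _⊖_ (≡.trans (+-comm q m) (≡.trans eq (+-comm p n))) (+-comm q n) ⟩
  (n + p) ⊖ (n + q) ≡⟨ ℤ.+-cancelˡ-⊖ n p q ⟩
  p ⊖ q             ∎
  where open ≡-Reasoning

signedSum₃ : ∀ {a b c l} (x y z : ℤ) →
  SignedSum (a ∷ b ∷ c ∷ l) (∣ x ∣ + (∣ y ∣ + ∣ z ∣)) (x ℤ.* + a ℤ.+ (y ℤ.* + b ℤ.+ z ℤ.* + c))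
signedSum₃ {a} {b} {c} {l} x y z =
  subst₂ (SignedSum _) (cong (λ t → ∣ x ∣ + (∣ y ∣ + t)) (+-identityʳ _))
    (cong (λ t → x ℤ.* + a ℤ.+ (y ℤ.* + b ℤ.+ t)) (ℤ.+-identityʳ _))
    (x ∷ (y ∷ (z ∷ signedSum-zero l)))

sum⁺₃ : ∀ {a b c l h n} x y z → x + (y + z) ≡ h → x * a + (y * b + z * c) ≡ n →
  Sum⁺ (a ∷ b ∷ c ∷ l) h n
sum⁺₃ {a} {b} {c} x y z refl refl = subst (SignedSum _ _) value (signedSum₃ (+ x) (+ y) (+ z))
  where
  value : + x ℤ.* + a ℤ.+ (+ y ℤ.* + b ℤ.+ + z ℤ.* + c) ≡ + (x * a + (y * b + z * c))
  value = cong₂ ℤ._+_ (sym (ℤ.pos-* x a)) (cong₂ ℤ._+_ (sym (ℤ.pos-* y b)) (sym (ℤ.pos-* z c)))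

sum⁻⁺⁺ : ∀ {a b c l h} m n x y z → x + (y + z) ≡ h → (y * b + z * c) + n ≡ m + x * a →
  SignedSum (a ∷ b ∷ c ∷ l) h (m ⊖ n)
sum⁻⁺⁺ {a} {b} {c} m n x y z refl eq =
  subst₂ (SignedSum _) (cong (_+ (y + z)) (ℤ.∣-i∣≡∣i∣ (+ x))) value (signedSum₃ (- + x) (+ y) (+ z))
  where
  open ≡-Reasoning
  value : - + x ℤ.* + a ℤ.+ (+ y ℤ.* + b ℤ.+ + z ℤ.* + c) ≡ m ⊖ n
  value = begin
    - + x ℤ.* + a ℤ.+ (+ y ℤ.* + b ℤ.+ + z ℤ.* + c)
      ≡⟨ cong₂ ℤ._+_ (≡.trans (sym (ℤ.neg-distribˡ-* (+ x) (+ a))) (cong -_ (sym (ℤ.pos-* x a))))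
           (cong₂ ℤ._+_ (sym (ℤ.pos-* y b)) (sym (ℤ.pos-* z c))) ⟩
    - + (x * a) ℤ.+ + (y * b + z * c)
      ≡⟨ ℤ.-m+n≡n⊖m (x * a) (y * b + z * c) ⟩
    (y * b + z * c) ⊖ (x * a)
      ≡⟨ ⊖-cong (y * b + z * c) (x * a) m n eq ⟩
    m ⊖ n ∎

sum⁻⁻⁺ : ∀ {a b c l h} m n x y z → x + (y + z) ≡ h → z * c + n ≡ m + (x * a + y * b) →
  SignedSum (a ∷ b ∷ c ∷ l) h (m ⊖ n)
sum⁻⁻⁺ {a} {b} {c} m n x y z refl eq =
  subst₂ (SignedSum _)
    (cong₂ (λ s t → s + (t + z)) (ℤ.∣-i∣≡∣i∣ (+ x)) (ℤ.∣-i∣≡∣i∣ (+ y)))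
    value (signedSum₃ (- + x) (- + y) (+ z))
  where
  open ≡-Reasoning
  factor : ∀ x a y b w → - x ℤ.* a ℤ.+ (- y ℤ.* b ℤ.+ w) ≡ - (x ℤ.* a ℤ.+ y ℤ.* b) ℤ.+ w
  factor = solveℤ-∀
  value : - + x ℤ.* + a ℤ.+ (- + y ℤ.* + b ℤ.+ + z ℤ.* + c) ≡ m ⊖ n
  value = begin
    - + x ℤ.* + a ℤ.+ (- + y ℤ.* + b ℤ.+ + z ℤ.* + c)
      ≡⟨ factor (+ x) (+ a) (+ y) (+ b) (+ z ℤ.* + c) ⟩
    - (+ x ℤ.* + a ℤ.+ + y ℤ.* + b) ℤ.+ + z ℤ.* + c
      ≡⟨ cong₂ (λ s t → - s ℤ.+ t)
           (cong₂ ℤ._+_ (sym (ℤ.pos-* x a)) (sym (ℤ.pos-* y b))) (sym (ℤ.pos-* z c)) ⟩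
    - + (x * a + y * b) ℤ.+ + (z * c)
      ≡⟨ ℤ.-m+n≡n⊖m (x * a + y * b) (z * c) ⟩
    (z * c) ⊖ (x * a + y * b)
      ≡⟨ ⊖-cong (z * c) (x * a + y * b) m n eq ⟩
    m ⊖ n ∎

sum⁺₂ : ∀ {a b l h} x y → x + y ≡ h → Sum⁺ (a ∷ b ∷ l) h (x * b + y * a)
sum⁺₂ {a} {b} {l} x y refl =
  subst₂ (SignedSum _)
    (≡.trans (cong₂ _+_ {x = y} refl (+-identityʳ x)) (+-comm y x)) value
    ((+ y) ∷ ((+ x) ∷ signedSum-zero l))
  where
  value : + y ℤ.* + a ℤ.+ (+ x ℤ.* + b ℤ.+ + 0) ≡ + (x * b + y * a)
  value = ≡.trans
    (cong₂ ℤ._+_ (sym (ℤ.pos-* y a)) (≡.trans (ℤ.+-identityʳ _) (sym (ℤ.pos-* x b))))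
    (cong +_ (+-comm (y * a) (x * b)))

-- Counting distinct elements

-- Pigeonhole: each step removes from `ys` the occurrence of the head of `xs`.
unique-⊆⇒length≤ : ∀ {A : Set} {xs ys : List A} → Unique xs → (∀ {x} → x ∈ xs → x ∈ ys) →
  length xs ≤ length ys
unique-⊆⇒length≤ [] sub = z≤n
unique-⊆⇒length≤ {xs = x ∷ xs} (x∉ ∷ u) sub with ys , zs , refl ← ∈-∃++ (sub (here refl)) =
  subst (suc (length xs) ≤_) (sym (↭-length (shift x ys zs)))
    (s≤s (unique-⊆⇒length≤ u λ z∈ → drop-head (All.lookup x∉ z∈) (∈-resp-↭ (shift x ys zs) (sub (there z∈)))))
  where
  drop-head : ∀ {z} {l : List _} → x ≢ z → z ∈ x ∷ l → z ∈ l
  drop-head x≢z (here z≡x) = contradiction (sym z≡x) x≢z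
  drop-head x≢z (there z∈) = z∈

all-disjoint : ∀ {A : Set} {P Q : A → Set} {xs ys} → (∀ {x} → P x → ¬ Q x) →
  All P xs → All Q ys → ∀ {x} → x ∈ xs × x ∈ ys → ⊥
all-disjoint P⇒¬Q ps qs (x∈xs , x∈ys) = P⇒¬Q (All.lookup ps x∈xs) (All.lookup qs x∈ys)

-- The interval is half-open so that adjacent ones concatenate without a repeated element. `lo≤hi`
-- is stored because an empty list would not imply it.
record Within (P : ℕ → Set) (lo hi n : ℕ) : Set where
  field
    elems  : List ℕ
    unique : Unique elems
    bounds : All (λ x → lo ≤ x × x ℕ.< hi × P x) elems
    size   : length elems ≡ n
    lo≤hi  : lo ≤ hi
open Within

within-append : ∀ {P lo mid hi m n} → Within P lo mid m → Within P mid hi n → Within P lo hi (m + n)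
within-append v w = record
  { elems  = elems v ++ elems w
  ; unique = Unique.++⁺ (unique v) (unique w)
      (all-disjoint (λ { (_ , x<mid , _) (mid≤x , _) → <⇒≱ x<mid mid≤x }) (bounds v) (bounds w))
  ; bounds = All.++⁺ (All.map (λ { (p , q , r) → p , <-≤-trans q (lo≤hi w) , r }) (bounds v))
                     (All.map (λ { (p , q , r) → ≤-trans (lo≤hi v) p , q , r }) (bounds w))
  ; size   = ≡.trans (length-++ (elems v)) (cong₂ _+_ (size v) (size w))
  ; lo≤hi  = ≤-trans (lo≤hi v) (lo≤hi w)
  }

within-single : ∀ {P x lo hi} → lo ≤ x → x ℕ.< hi → P x → Within P lo hi 1
within-single {x = x} lo≤x x<hi px = record
  { elems = x ∷ [] ; unique = [] ∷ [] ; bounds = (lo≤x , x<hi , px) ∷ [] ; size = refl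
  ; lo≤hi = ≤-trans lo≤x (<⇒≤ x<hi) }

within-pair : ∀ {P lo x y hi} → lo ≤ x → x ℕ.< y → y ℕ.< hi → P x → P y →
  Within P lo hi 2
within-pair lo≤x x<y y<hi px py = within-append (within-single lo≤x x<y px) (within-single ≤-refl y<hi py)

within-map : ∀ {P Q lo hi n} → (∀ {x} → P x → Q x) → Within P lo hi n → Within Q lo hi n
within-map f w = record
  { elems = elems w ; unique = unique w ; size = size w ; lo≤hi = lo≤hi w
  ; bounds = All.map (λ { (p , q , r) → p , q , f r }) (bounds w) }

-- The blocks telescope. The endpoint `f i j` takes both the count done and the count remaining, so
-- that expressions such as `i * v + j * u` need no subtraction.
within-iterate : ∀ {P c} n (f : ℕ → ℕ → ℕ) →
  (∀ i j → i + suc j ≡ n → Within P (f i (suc j)) (f (suc i) j) c) →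
  Within P (f 0 n) (f n 0) (n * c)
within-iterate zero f step = record
  { elems = [] ; unique = [] ; bounds = [] ; size = refl ; lo≤hi = ≤-refl }
within-iterate (suc n) f step =
  within-append (step 0 n refl) (within-iterate n (f ∘ suc) λ i j eq → step (suc i) j (cong suc eq))

module _ {l : List ℕ} {h N : ℕ}
         (bound : ∀ xs → Unique xs → All (SignedSum l h) xs → length xs ≤ N) where

  -- The list `pos`, its negatives and `mid` are pairwise disjoint: absolute values separate `mid`
  -- from the other two, which differ in sign.
  symmetric-count : ∀ {lo} pos mid → 1 ≤ lo →
    Unique pos → All (λ x → lo ≤ x × Sum⁺ l h x) pos →
    Unique mid → All (λ v → ∣ v ∣ ℕ.< lo × SignedSum l h v) mid →
    length pos + (length mid + length pos) ≤ N
  symmetric-count {lo} pos mid 1≤lo uniq⁺ all⁺ uniqᵐ allᵐ = subst (_≤ N) size-eq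
    (bound (neg ++ mid ++ map +_ pos)
      (Unique.++⁺ (Unique.map⁺ (ℤ.+-injective ∘ ℤ.neg-injective) uniq⁺)
        (Unique.++⁺ uniqᵐ (Unique.map⁺ ℤ.+-injective uniq⁺)
          (all-disjoint (λ p q → <⇒≱ (proj₁ p) q) allᵐ
            (All.map⁺ {P = λ v → lo ≤ ∣ v ∣} (All.map proj₁ all⁺))))
        (all-disjoint (λ { (p , q) (inj₁ r) → <⇒≱ r q ; (p , q) (inj₂ r) → p _ r })
          (All.map⁺ {P = λ v → (∀ n → v ≢ + n) × lo ≤ ∣ v ∣}
            (All.map (λ {x} p → neg≢pos x (≤-trans 1≤lo (proj₁ p)) ,
                                subst (lo ≤_) (sym (ℤ.∣-i∣≡∣i∣ (+ x))) (proj₁ p)) all⁺))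
          (All.++⁺ (All.map (inj₁ ∘ proj₁) allᵐ)
            (All.map⁺ {P = λ v → ∣ v ∣ ℕ.< lo ⊎ v ≡ + ∣ v ∣} (All.map (λ _ → inj₂ refl) all⁺)))))
      (All.++⁺ (All.map⁺ (All.map (signedSum-neg ∘ proj₂) all⁺))
        (All.++⁺ (All.map proj₂ allᵐ) (All.map⁺ (All.map proj₂ all⁺)))))
    where
    neg = map (λ x → - (+ x)) pos
    neg≢pos : ∀ x → 1 ≤ x → ∀ n → - (+ x) ≢ + n
    neg≢pos (suc x) _ n ()
    size-eq : length (neg ++ mid ++ map +_ pos) ≡ length pos + (length mid + length pos)
    size-eq = ≡.trans (length-++ neg) (cong₂ _+_ (length-map _ pos)
      (≡.trans (length-++ mid) (cong₂ _+_ refl (length-map _ pos))))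

-- Sums of consecutive pairs

Step : (ℕ → Set) → ℕ → ℕ → ℕ → Set
Step P h u v = u ℕ.< v × (∀ i j → i + j ≡ h → P (i * v + j * u))

-- The upper end is hidden because blocks are only ever added on the left.
From : (ℕ → Set) → ℕ → ℕ → Set
From P lo n = Σ ℕ λ hi → Within P lo hi n

from-append : ∀ {P lo mid m n} → Within P lo mid m → From P mid n → From P lo (m + n)
from-append v (hi , w) = hi , within-append v w

-- Replacing one `u` by `v` at a time increases the sum. The final value `h * v` is left out, as it
-- opens the next segment.
segment : ∀ {P h u v} → Step P h u v → Within P (h * u) (h * v) h
segment {P} {h} {u} {v} (u<v , sums) =
  subst₂ (Within P (h * u)) (+-identityʳ (h * v)) (*-identityʳ h)
    (within-iterate h (λ i j → i * v + j * u) λ i j eq →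
      within-single ≤-refl (increase i j) (sums i (suc j) eq))
  where
  pull : ∀ x y z → y + (x + z) ≡ x + (y + z)
  pull = solve-∀
  increase : ∀ i j → i * v + suc j * u ℕ.< suc i * v + j * u
  increase i j = subst₂ ℕ._<_ (sym (pull u (i * v) (j * u))) (sym (+-assoc v (i * v) (j * u)))
    (+-monoˡ-< (i * v + j * u) u<v)

chain : ∀ {P h a l} → P (h * a) → Linked (Step P h) (a ∷ l) → From P (h * a) (h * length l + 1)
chain {P} {h} {a} pa [-] =
  -- No segment follows the last element, so its h-fold multiple is counted here; this is the `+ 1`.
  suc (h * a) , subst (λ s → Within P (h * a) (suc (h * a)) (s + 1)) (sym (*-zeroʳ h))
    (within-single ≤-refl (n<1+n (h * a)) pa)
chain {P} {h} {a} {b ∷ l} pa (step ∷ steps) =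
  subst (From P (h * a)) size-eq (from-append (segment step) (chain pb steps))
  where
  pb : P (h * b)
  pb = subst P (+-identityʳ (h * b)) (proj₂ step h 0 (+-identityʳ h))
  size-eq : h + (h * length l + 1) ≡ h * suc (length l) + 1
  size-eq = ≡.trans (sym (+-assoc h (h * length l) 1)) (cong (_+ 1) (sym (*-suc h (length l))))

-- The sums are over the whole list, so those found in the tail receive a zero coefficient for the
-- new head.
linked-sums : ∀ {R : ℕ → ℕ → Set} {h l} → Linked R l →
  Linked (λ u v → R u v × (∀ i j → i + j ≡ h → Sum⁺ l h (i * v + j * u))) l
linked-sums [] = []
linked-sums [-] = [-]
linked-sums (r ∷ rs) =
  (r , sum⁺₂) ∷ Linked.map (λ { (r , p) → r , λ i j eq → signedSum-weaken (p i j eq) }) (linked-sums rs)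

sum⁺₁ : ∀ a l h → Sum⁺ (a ∷ l) h (h * a)
sum⁺₁ a l h = subst₂ (SignedSum (a ∷ l)) (+-identityʳ h)
  (≡.trans (ℤ.+-identityʳ _) (sym (ℤ.pos-* h a))) ((+ h) ∷ signedSum-zero l)

increasing-count : ∀ {h a l} → Linked ℕ._<_ (a ∷ l) →
  From (Sum⁺ (a ∷ l) h) (h * a) (h * length l + 1)
increasing-count {h} {a} {l} inc = chain (sum⁺₁ a l h) (linked-sums inc)

-- Sets that are not arithmetic progressions

data Bent : List ℕ → Set where
  here  : ∀ {a b c l} → a + c ≢ b + b → Bent (a ∷ b ∷ c ∷ l)
  there : ∀ {a b l} → Bent (b ∷ l) → Bent (a ∷ b ∷ l)

-- Between consecutive terms i c + (h − i) b, a second sum is obtained from the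
-- larger of them by replacing one b with a.
convex-count : ∀ {a b c l} n → let h = suc n in a ℕ.< b → b ℕ.< c → b + b ℕ.< a + c →
  Within (Sum⁺ (a ∷ b ∷ c ∷ l) h) (h * a) (h * c) (h + (n * 2 + 1))
convex-count {a} {b} {c} {l} n a<b b<c bb<ac =
  within-append (segment (a<b , sum⁺₂)) (within-append
    (within-iterate n (λ i j → i * c + suc j * b) block)
    -- The last gap, below `h * c`, gets no second sum: its larger term has no b to replace.
    (within-single ≤-refl last (sum⁺₃ 0 1 n refl (value₂ n b c))))
  where
  P = Sum⁺ (a ∷ b ∷ c ∷ l) (suc n)
  value₂ : ∀ n b c → 1 * b + n * c ≡ n * c + 1 * b
  value₂ = solve-∀
  last : n * c + 1 * b ℕ.< suc n * c
  last = subst (ℕ._< suc n * c) (≡.trans (cong (_+ n * c) (sym (*-identityˡ b))) (value₂ n b c))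
    (+-monoˡ-< (n * c) b<c)
  count₁ : ∀ i j → 0 + (suc (suc j) + i) ≡ suc (i + suc j)
  count₁ = solve-∀
  value₁ : ∀ i j a b c → 0 * a + (suc (suc j) * b + i * c) ≡ i * c + suc (suc j) * b
  value₁ = solve-∀
  count₃ : ∀ i j → 1 + (j + suc i) ≡ suc (i + suc j)
  count₃ = solve-∀
  value₃ : ∀ i j a b c → 1 * a + (j * b + suc i * c) ≡ (i * c + j * b) + (a + c)
  value₃ = solve-∀
  lower : ∀ i j b c → (i * c + j * b) + (b + b) ≡ i * c + suc (suc j) * b
  lower = solve-∀
  upper : ∀ i j b c → (i * c + j * b) + (b + c) ≡ suc i * c + suc j * b
  upper = solve-∀
  block : ∀ i j → i + suc j ≡ n → Within P (i * c + suc (suc j) * b) (suc i * c + suc j * b) 2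
  block i j eq = within-pair ≤-refl
    (subst (ℕ._< (i * c + j * b) + (a + c)) (lower i j b c) (+-monoʳ-< (i * c + j * b) bb<ac))
    (subst ((i * c + j * b) + (a + c) ℕ.<_) (upper i j b c) (+-monoʳ-< (i * c + j * b) (+-monoˡ-< c a<b)))
    (sum⁺₃ 0 (suc (suc j)) i (≡.trans (count₁ i j) (cong suc eq)) (value₁ i j a b c))
    (sum⁺₃ 1 j (suc i) (≡.trans (count₃ i j) (cong suc eq)) (value₃ i j a b c))

-- Between consecutive terms i b + (h − i) a, a second sum is obtained from the
-- smaller of them by replacing one b with c.
concave-count : ∀ {a b c l} n → let h = suc n in a ℕ.< b → b ℕ.< c → a + c ℕ.< b + b →
  Within (Sum⁺ (a ∷ b ∷ c ∷ l) h) (h * a) (h * c) (h + (n * 2 + 1))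
concave-count {a} {b} {c} {l} n a<b b<c ac<bb =
  subst (Within P (suc n * a) (suc n * c)) (size-eq n)
    -- The first gap, above `h * a`, gets no second sum: its smaller term has no b to replace.
    (within-append (within-single ≤-refl first (sum⁺₃ (suc n) 0 0 (cong suc (+-identityʳ n)) (+-identityʳ _)))
      (within-append
        (subst (λ t → Within P (1 * b + n * a) t (n * 2)) (+-identityʳ (suc n * b))
          (within-iterate n (λ i j → suc i * b + j * a) block))
        (segment (b<c , λ i j eq → signedSum-weaken (sum⁺₂ i j eq)))))
  where
  P = Sum⁺ (a ∷ b ∷ c ∷ l) (suc n)
  size-eq : ∀ n → 1 + (n * 2 + suc n) ≡ suc n + (n * 2 + 1)
  size-eq = solve-∀
  first : suc n * a ℕ.< 1 * b + n * a
  first = subst (suc n * a ℕ.<_) (cong (_+ n * a) (sym (*-identityˡ b))) (+-monoˡ-< (n * a) a<b)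
  count₁ : ∀ i j → suc j + (suc i + 0) ≡ suc (i + suc j)
  count₁ = solve-∀
  value₁ : ∀ i j a b c → suc j * a + (suc i * b + 0 * c) ≡ suc i * b + suc j * a
  value₁ = solve-∀
  count₃ : ∀ i j → suc j + (i + 1) ≡ suc (i + suc j)
  count₃ = solve-∀
  value₃ : ∀ i j a b c → suc j * a + (i * b + 1 * c) ≡ (i * b + j * a) + (a + c)
  value₃ = solve-∀
  lower : ∀ i j a b → (i * b + j * a) + (a + b) ≡ suc i * b + suc j * a
  lower = solve-∀
  upper : ∀ i j a b → (i * b + j * a) + (b + b) ≡ suc (suc i) * b + j * a
  upper = solve-∀
  block : ∀ i j → i + suc j ≡ n → Within P (suc i * b + suc j * a) (suc (suc i) * b + j * a) 2
  block i j eq = within-pair ≤-refl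
    (subst (ℕ._< (i * b + j * a) + (a + c)) (lower i j a b) (+-monoʳ-< (i * b + j * a) (+-monoʳ-< a b<c)))
    (subst ((i * b + j * a) + (a + c) ℕ.<_) (upper i j a b) (+-monoʳ-< (i * b + j * a) ac<bb))
    (sum⁺₃ (suc j) (suc i) 0 (≡.trans (count₁ i j) (cong suc eq)) (value₁ i j a b c))
    (sum⁺₃ (suc j) i 1 (≡.trans (count₃ i j) (cong suc eq)) (value₃ i j a b c))

-- One bend suffices: the two links of the bent triple contribute 2h + (h - 1) sums, every other
-- link contributes h, and the largest element adds one more.
bent-count : ∀ {a l} n → let h = suc n in Linked ℕ._<_ (a ∷ l) → Bent (a ∷ l) →
  From (Sum⁺ (a ∷ l) h) (h * a) (h * suc (length l))
bent-count {a} {b ∷ l} n (a<b ∷ inc) (there bent) =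
  subst (From _ _) (sym (*-suc (suc n) (suc (length l))))
    (from-append (segment (a<b , sum⁺₂)) (_ , within-map signedSum-weaken (proj₂ (bent-count n inc bent))))
bent-count {a} {b ∷ c ∷ l} n (a<b ∷ b<c ∷ inc) (here ac≢bb) =
  subst (From _ _) (size-eq n (length l))
    (from-append triple
      (_ , within-map (signedSum-weaken ∘ signedSum-weaken) (proj₂ (increasing-count inc))))
  where
  size-eq : ∀ n k → (suc n + (n * 2 + 1)) + (suc n * k + 1) ≡ suc n * suc (suc (suc k))
  size-eq = solve-∀
  triple : Within (Sum⁺ (a ∷ b ∷ c ∷ l) (suc n)) (suc n * a) (suc n * c) (suc n + (n * 2 + 1))
  triple with <-cmp (a + c) (b + b)
  ... | tri< ac<bb _ _ = concave-count n a<b b<c ac<bb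
  ... | tri≈ _ ac≡bb _ = contradiction ac≡bb ac≢bb
  ... | tri> _ _ bb<ac = convex-count n a<b b<c bb<ac

-- Arithmetic progressions

progression : ℕ → ℕ → ℕ → List ℕ
progression a d zero    = []
progression a d (suc k) = a ∷ progression (a + d) d k

length-progression : ∀ a d k → length (progression a d k) ≡ k
length-progression a d zero    = refl
length-progression a d (suc k) = cong suc (length-progression (a + d) d k)

double-middle : ∀ a d → (a + d) + (a + d) ≡ a + (a + d + d)
double-middle = solve-∀

-- The first two terms fix the difference; each further term either continues it or makes a bend.
-- Keeping `a` outside the progression lets the recursion move on to the next pair.
progression-or-bent : ∀ a d l → let b = a + d in
  b ∷ l ≡ progression b d (suc (length l)) ⊎ Bent (a ∷ b ∷ l)
progression-or-bent a d [] = inj₁ refl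
progression-or-bent a d (c ∷ l) with (a + c) ≟ ((a + d) + (a + d))
... | no  bend = inj₂ (here bend)
... | yes flat with refl ← +-cancelˡ-≡ a c (a + d + d) (≡.trans flat (double-middle a d))
  with progression-or-bent (a + d) d l
... | inj₁ eq   = inj₁ (cong (a + d ∷_) eq)
... | inj₂ bent = inj₂ (there bent)

-- This supplies the number m of blocks for `middle-count`: the first bound keeps the offsets below
-- 2 h a, the second makes the count 2m + 1 reach h.
halve : ∀ h → Σ ℕ λ m → m + m ≤ h × h ≤ m * 2 + 1
halve zero          = 0 , z≤n , z≤n
halve (suc zero)    = 0 , z≤n , s≤s z≤n
halve (suc (suc h)) with m , lo , hi ← halve h =
  suc m , s≤s (subst (_≤ suc h) (sym (+-suc m m)) (s≤s lo)) , s≤s (s≤s hi)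

module _ (a d n : ℕ) (0<a : 0 ℕ.< a) (0<d : 0 ℕ.< d) (l : List ℕ) where

  private
    b = a + d
    c = a + d + d
    h = suc (suc (suc n))
    L : List ℕ
    L = a ∷ b ∷ c ∷ l
    w = a + b

  -- The offsets above −h a are 2a, i (a + b) and i (a + b) + d for 1 ≤ i ≤ h / 2.
  middle-count : d ≤ a → ∀ m → m + m ≤ h → h ≤ m * 2 + 1 →
    Within (λ o → SignedSum L h (o ⊖ h * a)) d (h * a + h * a) (m * 2 + 1)
  middle-count d≤a m 2m≤h h≤2m+1 =
    within-append (within-iterate m (λ i j → i * w + d) block)
      (within-single ≤-refl top (shifted m (1≤m m h≤2m+1) (≤-trans (m≤m+n m m) 2m≤h)))
    where
    Q = λ o → SignedSum L h (o ⊖ h * a)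
    1≤m : ∀ m → h ≤ m * 2 + 1 → 1 ≤ m
    1≤m (suc m) _ = s≤s z≤n
    1≤m zero (s≤s ())

    value : ∀ i t a d → (i * (a + d) + 0 * (a + d + d)) + (i + t) * a ≡ i * (a + (a + d)) + t * a
    value = solve-∀
    value′ : ∀ i t a d →
      (i * (a + d) + 1 * (a + d + d)) + (suc i + t) * a ≡ (suc i * (a + (a + d)) + d) + t * a
    value′ = solve-∀
    value″ : ∀ n a d → 1 * (a + d + d) + suc (suc (suc n)) * a ≡ (a + a) + (n * a + 2 * (a + d))
    value″ = solve-∀
    rotate : ∀ i t → t + (i + 0) ≡ i + t
    rotate = solve-∀
    rotate′ : ∀ i t → t + (i + 1) ≡ suc i + t
    rotate′ = solve-∀

    -- Turning i copies of -a into b raises -h a by `i * w`.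
    plain : ∀ i → i ≤ h → Q (i * w)
    plain i i≤h with t , eq ← m≤n⇒∃[o]m+o≡n i≤h =
      sum⁻⁺⁺ (i * w) (h * a) t i 0 (≡.trans (rotate i t) eq)
        (subst (λ s → (i * b + 0 * c) + s * a ≡ i * w + t * a) eq (value i t a d))
    -- Turning one of the i copies of b into c adds d, whence the condition 1 ≤ i.
    shifted : ∀ i → 1 ≤ i → i ≤ h → Q (i * w + d)
    shifted (suc i) _ i≤h with t , eq ← m≤n⇒∃[o]m+o≡n i≤h =
      sum⁻⁺⁺ (suc i * w + d) (h * a) t i 1 (≡.trans (rotate′ i t) eq)
        (subst (λ s → (i * b + 1 * c) + s * a ≡ (suc i * w + d) + t * a) eq (value′ i t a d))
    -- Since c - 2b = -a, the coefficients -n, -2, 1 give -(h - 2) a. Their weight is n + 3, which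
    -- requires h ≥ 3.
    double : Q (a + a)
    double = sum⁻⁻⁺ (a + a) (h * a) n 2 1 (+-comm n 3) (value″ n a d)

    d<w : d ℕ.< w
    d<w = ≤-trans (+-monoˡ-≤ d 0<a) (m≤n+m b a)
    block : ∀ i j → i + suc j ≡ m → Within Q (i * w + d) (suc i * w + d) 2
    block i j eq = pair i (≤-trans (≤-trans (s≤s (m≤m+n i j)) (≤-reflexive (≡.trans (sym (+-suc i j)) eq)))
                                   (≤-trans (m≤m+n m m) 2m≤h))
      where
      next : ∀ i → suc i * w ℕ.< suc i * w + d
      next i = m<m+n (suc i * w) 0<d
      pair : ∀ i → suc i ≤ h → Within Q (i * w + d) (suc i * w + d) 2
      -- `shifted` does not provide the offset d, so 2a takes its place in the first block; d ≤ a
      -- makes 2a large enough for it.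
      pair zero i<h = within-pair (≤-trans d≤a (m≤m+n a a))
        (subst (a + a ℕ.<_) (≡.trans (+-assoc a a d) (sym (+-identityʳ w))) (m<m+n (a + a) 0<d))
        (next 0) double (plain 1 i<h)
      pair (suc i) i<h = within-pair ≤-refl
        (subst (ℕ._< suc (suc i) * w) (+-comm d (suc i * w)) (+-monoˡ-< (suc i * w) d<w))
        (next (suc i)) (shifted (suc i) (s≤s z≤n) (<⇒≤ i<h)) (plain (suc (suc i)) i<h)

    -- From d ≤ a follows w ≤ 3a, so the largest offset is at most (3m + 1) a, to be compared with 2
    -- h a. After doubling, m + m ≤ h leaves 3h + 2 < 4h, true for h ≥ 3.
    3m+1<2h : m * 3 + 1 ℕ.< h + h
    3m+1<2h = *-cancelˡ-< 2 _ _ (begin-strict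
      2 * (m * 3 + 1)   ≡⟨ e₁ m ⟩
      (m + m) * 3 + 2   ≤⟨ +-monoˡ-≤ 2 (*-monoˡ-≤ 3 2m≤h) ⟩
      h * 3 + 2         <⟨ +-monoʳ-< (h * 3) (s≤s (s≤s (s≤s z≤n))) ⟩
      h * 3 + h         ≡⟨ e₂ h ⟩
      2 * (h + h)       ∎)
      where
      open ≤-Reasoning
      e₁ : ∀ m → 2 * (m * 3 + 1) ≡ (m + m) * 3 + 2
      e₁ = solve-∀
      e₂ : ∀ h → h * 3 + h ≡ 2 * (h + h)
      e₂ = solve-∀
    top : m * w + d ℕ.< h * a + h * a
    top = begin-strict
      m * w + d             ≤⟨ +-mono-≤ (*-monoʳ-≤ m (+-monoʳ-≤ a (+-monoʳ-≤ a d≤a))) d≤a ⟩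
      m * (a + (a + a)) + a ≡⟨ e₁ m a ⟩
      (m * 3 + 1) * a       <⟨ *-monoˡ-< a {{ℕ.>-nonZero 0<a}} 3m+1<2h ⟩
      (h + h) * a           ≡⟨ *-distribʳ-+ a h h ⟩
      h * a + h * a         ∎
      where
      open ≤-Reasoning
      e₁ : ∀ m a → m * (a + (a + a)) + a ≡ (m * 3 + 1) * a
      e₁ = solve-∀

  -- The sums −a + j b + i c with i + j = h − 1.
  shifted-count : let base = suc n * a + suc (suc n) * d in
    Within (λ x → Sum⁺ L h x × Σ ℕ λ i → x ≡ suc n * a + (suc (suc n) + i) * d)
      base (base + h * d) h
  shifted-count = subst₂ (λ s → Within P s (base + h * d)) (+-identityʳ base) (*-identityʳ h)
    (within-iterate h (λ i j → base + i * d) λ i j eq →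
      within-single ≤-refl (+-monoʳ-< base (m<n+m (i * d) 0<d))
        -- With subtrahend 0, `_⊖_` computes to a natural, as `Sum⁺` requires.
        ( sum⁻⁺⁺ (base + i * d) 0 1 j i
            (≡.trans (≡.trans (cong suc (+-comm j i)) (sym (+-suc i j))) eq)
            (value i j (suc-injective (≡.trans (sym (+-suc i j)) eq)))
        , i , collect n i a d))
    where
    base = suc n * a + suc (suc n) * d
    P : ℕ → Set
    P x = Sum⁺ L h x × Σ ℕ λ i → x ≡ suc n * a + (suc (suc n) + i) * d
    collect : ∀ n i a d → (suc n * a + suc (suc n) * d) + i * d ≡ suc n * a + (suc (suc n) + i) * d
    collect = solve-∀
    expand : ∀ i j a d → (j * (a + d) + i * (a + d + d)) + 0 ≡ (i + j) * (a + d) + i * d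
    expand = solve-∀
    value′ : ∀ n i a d → suc (suc n) * (a + d) + i * d ≡ ((suc n * a + suc (suc n) * d) + i * d) + 1 * a
    value′ = solve-∀
    value : ∀ i j → i + j ≡ suc (suc n) → (j * b + i * c) + 0 ≡ (base + i * d) + 1 * a
    value i j eq = ≡.trans (expand i j a d)
      (≡.trans (cong (λ s → s * b + i * d) eq) (value′ n i a d))

⊖-injectiveˡ : ∀ n {x y} → x ⊖ n ≡ y ⊖ n → x ≡ y
⊖-injectiveˡ n {x} {y} eq with <-cmp x y
... | tri< x<y _ _ = contradiction (ℤ.⊖-monoˡ-< n x<y) (ℤ.<-irrefl eq)
... | tri≈ _ x≡y _ = x≡y
... | tri> _ _ y<x = contradiction (ℤ.⊖-monoˡ-< n y<x) (ℤ.<-irrefl (sym eq))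

∣⊖∣< : ∀ {x n} → 0 ℕ.< x → 0 ℕ.< n → x ℕ.< n + n → ∣ x ⊖ n ∣ ℕ.< n
∣⊖∣< {x} {n} 0<x 0<n x<2n with ≤-total x n
... | inj₁ x≤n = subst (ℕ._< n) (sym (ℤ.∣⊖∣-≤ x≤n)) (∸-monoʳ-< 0<x x≤n)
... | inj₂ n≤x = subst (ℕ._< n) (sym (cong ∣_∣ (ℤ.⊖-≥ n≤x)))
  (subst (x ∸ n ℕ.<_) (m+n∸n≡m n n) (∸-monoˡ-< x<2n n≤x))

ConsecutiveTerms : ℕ → ℕ → ℕ → ℕ → Set
ConsecutiveTerms a d u v = u ℕ.< v × v ≡ u + d × Σ ℕ λ s → u ≡ a + s * d

progression-linked : ∀ a d → 0 ℕ.< d → ∀ s k →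
  Linked (ConsecutiveTerms a d) (progression (a + s * d) d k)
progression-linked a d 0<d s zero = []
progression-linked a d 0<d s (suc zero) = [-]
progression-linked a d 0<d s (suc (suc k)) =
  (m<m+n _ 0<d , refl , s , refl) ∷
    subst (λ t → Linked (ConsecutiveTerms a d) (progression t d (suc k))) (next a s d) (progression-linked a d 0<d (suc s) (suc k))
  where
  next : ∀ a s d → a + suc s * d ≡ (a + s * d) + d
  next = solve-∀

-- Every term is congruent to a modulo d and the coefficients used are nonnegative with sum h, so
-- each of these sums is congruent to h a. The witness `t` is kept for the comparison with
-- `shifted-count`.
progression-count : ∀ a d h k → 0 ℕ.< d →
  From (λ x → Sum⁺ (progression a d (suc k)) h x × Σ ℕ λ t → x ≡ h * a + t * d) (h * a) (h * k + 1)
progression-count a d h k 0<d =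
  subst (λ s → From P (h * a) (h * s + 1)) (length-progression (a + d) d k)
    (chain (sum⁺₁ a (progression (a + d) d k) h , 0 , sym (+-identityʳ (h * a)))
      (Linked.map step (linked-sums
        (subst (λ t → Linked (ConsecutiveTerms a d) (progression t d (suc k))) (+-identityʳ a) (progression-linked a d 0<d 0 (suc k))))))
  where
  P : ℕ → Set
  P x = Sum⁺ (progression a d (suc k)) h x × Σ ℕ λ t → x ≡ h * a + t * d
  value : ∀ i j a d s → i * ((a + s * d) + d) + j * (a + s * d) ≡ (i + j) * a + (i + (i + j) * s) * d
  value = solve-∀
  step : ∀ {u v} →
    ConsecutiveTerms a d u v ×
      (∀ i j → i + j ≡ h → Sum⁺ (progression a d (suc k)) h (i * v + j * u)) →
    Step P h u v
  step ((u<v , refl , s , refl) , sums) = u<v , λ i j eq → sums i j eq , i + h * s ,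
    ≡.trans (value i j a d s) (cong (λ t → t * a + (i + t * s) * d) eq)

-- Contradictions with the assumed cardinality

-- Adding h to both sides clears the truncated subtraction, which is exact since h ≤ 2 h (k + 1).
exceeds : ∀ h k X → 2 * h * suc k + 2 ≤ X + h → ¬ X ≤ (2 * h * suc k ∸ h) + 1
exceeds h k X big small = <⇒≱ (≤-trans (≤-reflexive (sym (+-suc M 1))) big)
  (begin
    X + h           ≤⟨ +-monoˡ-≤ h small ⟩
    (M ∸ h) + 1 + h ≡⟨ swap-last (M ∸ h) h ⟩
    (M ∸ h) + h + 1 ≡⟨ cong (_+ 1) (m∸n+n≡m h≤M) ⟩
    M + 1           ∎)
  where
  open ≤-Reasoning
  M = 2 * h * suc k
  swap-last : ∀ x h → x + 1 + h ≡ x + h + 1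
  swap-last = solve-∀
  h≤M : h ≤ M
  h≤M = ≤-trans (m≤n*m h 2) (m≤m*n (2 * h) (suc k))

-- The coefficients of a on the two sides are h - 2 and h, so an equality would make d divide 2a. As
-- 0 < 2a < 2d, the quotient would be 1, that is, d = 2a.
not-congruent : ∀ {a d} → 0 ℕ.< a → a ℕ.< d → d ≢ 2 * a → ∀ n i t →
  suc n * a + (suc (suc n) + i) * d ≢ suc (suc (suc n)) * a + t * d
not-congruent {a} {d} 0<a a<d d≢2a n i t eq =
  excluded (∣m+n∣m⇒∣n (divides (suc (suc n) + i) (sym cancelled)) (divides t refl))
  where
  e₁ : ∀ n a t d → suc (suc (suc n)) * a + t * d ≡ suc n * a + (t * d + 2 * a)
  e₁ = solve-∀
  cancelled : (suc (suc n) + i) * d ≡ t * d + 2 * a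
  cancelled = +-cancelˡ-≡ (suc n * a) _ _ (≡.trans eq (e₁ n a t d))
  excluded : ¬ d ∣ 2 * a
  excluded (divides zero eq) = <⇒≢ (≤-trans 0<a (m≤n*m a 2)) (sym eq)
  excluded (divides (suc zero) eq) = d≢2a (≡.trans (sym (+-identityʳ d)) (sym eq))
  excluded (divides (suc (suc q)) eq) = <⇒≢ (<-≤-trans (*-monoʳ-< 2 a<d) (*-monoˡ-≤ d (s≤s (s≤s (z≤n {q}))))) eq

SizeBound : List ℕ → ℕ → ℕ → Set
SizeBound l h k = ∀ xs → Unique xs → All (SignedSum l h) xs → length xs ≤ (2 * h * k ∸ h) + 1

-- For k elements, a bend yields h k positive sums; with their negatives this makes 2 h k, more than
-- 2 h k - h + 1 as h ≥ 2.
bent-impossible : ∀ {a l} n → let h = suc (suc n) in 0 ℕ.< a → Linked ℕ._<_ (a ∷ l) →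
  SizeBound (a ∷ l) h (suc (length l)) → ¬ Bent (a ∷ l)
bent-impossible {a} {l} n 0<a inc bound bent =
  exceeds h k (length (elems w) + (0 + length (elems w)))
    (subst (λ s → 2 * h * suc k + 2 ≤ (s + (0 + s)) + h) (sym (size w)) (begin
      2 * h * suc k + 2                   ≤⟨ +-monoʳ-≤ (2 * h * suc k) (s≤s (s≤s z≤n)) ⟩
      2 * h * suc k + h                   ≡⟨ regroup h (suc k) ⟩
      (h * suc k + (0 + h * suc k)) + h   ∎))
    (symmetric-count bound (elems w) [] (*-mono-≤ (s≤s (z≤n {suc n})) 0<a) (unique w)
      (All.map (λ { (p , _ , q) → p , q }) (bounds w)) [] [])
  where
  open ≤-Reasoning
  h = suc (suc n)
  k = length l
  w = proj₂ (bent-count (suc n) inc bent)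
  regroup : ∀ h k → 2 * h * k + h ≡ (h * k + (0 + h * k)) + h
  regroup = solve-∀

module _ (n a d k : ℕ) (0<a : 0 ℕ.< a) (0<d : 0 ℕ.< d)
         (bound : SizeBound (progression a d (3 + k)) (3 + n) (3 + k)) where

  private
    h = 3 + n
    K = 2 + k
    w = proj₂ (progression-count a d h K 0<d)
    1≤ha : 1 ≤ h * a
    1≤ha = *-mono-≤ (s≤s (z≤n {suc (suc n)})) 0<a

  -- There are `h * K + 1` sums from h a upwards, as many negatives, and at least h sums strictly
  -- between -h a and h a. The total is at least 2 h (K + 1) - h + 2, one too many for `suc K`
  -- elements.
  difference-large : ¬ d ≤ a
  difference-large d≤a with m , 2m≤h , h≤2m+1 ← halve h =
    exceeds h K (length (elems w) + (length mid + length (elems w)))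
      (subst₂ (λ s t → 2 * h * suc K + 2 ≤ (s + (t + s)) + h) (sym (size w))
        (sym (≡.trans (length-map centre (elems v)) (size v))) (begin
        2 * h * suc K + 2                                   ≡⟨ regroup h K ⟩
        ((h * K + 1) + (h + (h * K + 1))) + h
          ≤⟨ +-monoˡ-≤ h (+-monoʳ-≤ (h * K + 1) (+-monoˡ-≤ (h * K + 1) h≤2m+1)) ⟩
        ((h * K + 1) + ((m * 2 + 1) + (h * K + 1))) + h     ∎))
      (symmetric-count bound (elems w) mid 1≤ha (unique w)
        (All.map (λ { (p , _ , q , _) → p , q }) (bounds w))
        (Unique.map⁺ (⊖-injectiveˡ (h * a)) (unique v))
        (All.map⁺ (All.map (λ { (p , q , r) → ∣⊖∣< (≤-trans 0<d p) 1≤ha q , r }) (bounds v))))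
    where
    open ≤-Reasoning
    v = middle-count a d n 0<a 0<d (progression (a + d + d + d) d k) d≤a m 2m≤h h≤2m+1
    centre : ℕ → ℤ
    centre o = o ⊖ h * a
    mid = map centre (elems v)
    regroup : ∀ h K → 2 * h * suc K + 2 ≡ ((h * K + 1) + (h + (h * K + 1))) + h
    regroup = solve-∀

  -- Otherwise `shifted-count` adds h positive sums to the `h * K + 1` known ones; with the
  -- negatives this makes 2 h (K + 1) + 2.
  difference-double : d ≡ 2 * a
  difference-double with d ≟ (2 * a)
  ... | yes d≡2a = d≡2a
  ... | no  d≢2a = contradiction
    (symmetric-count bound (elems w ++ elems v) [] ≤-refl
      -- The ranges of the two families may overlap, so disjointness comes from residues modulo d.
      (Unique.++⁺ (unique w) (unique v)
        (all-disjoint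
          (λ { (_ , _ , _ , t , p) (_ , _ , _ , i , q) →
               not-congruent 0<a (≰⇒> difference-large) d≢2a n i t (≡.trans (sym q) p) })
          (bounds w) (bounds v)))
      (All.++⁺ (All.map (λ { (p , _ , q , _) → ≤-trans 1≤ha p , q }) (bounds w))
               (All.map (λ { (p , _ , q , _) → ≤-trans 1≤base p , q }) (bounds v)))
      [] [])
    (exceeds h K _
      (subst (λ s → 2 * h * suc K + 2 ≤ (s + (0 + s)) + h)
        (sym (≡.trans (length-++ (elems w)) (cong₂ _+_ (size w) (size v)))) (begin
        2 * h * suc K + 2                                       ≤⟨ m≤m+n (2 * h * suc K + 2) h ⟩
        (2 * h * suc K + 2) + h                                 ≡⟨ regroup h K ⟩
        (((h * K + 1) + h) + (0 + ((h * K + 1) + h))) + h       ∎)))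
    where
    open ≤-Reasoning
    v = shifted-count a d n 0<a 0<d (progression (a + d + d + d) d k)
    1≤base : 1 ≤ suc n * a + suc (suc n) * d
    1≤base = ≤-trans (*-mono-≤ (s≤s (z≤n {n})) 0<a) (m≤m+n (suc n * a) (suc (suc n) * d))
    regroup : ∀ h K → (2 * h * suc K + 2) + h ≡ (((h * K + 1) + h) + (0 + ((h * K + 1) + h))) + h
    regroup = solve-∀

-- The multiples d, 3d, 5d, ... form the progression with first term d and difference 2d, so the
-- dilation factor is the smallest element.
odd-multiples : ∀ n l → Linked ℕ._<_ l → All (0 ℕ.<_) l → 3 ≤ length l →
  SizeBound l (3 + n) (length l) →
  Σ ℕ λ d → 1 ≤ d × l ≡ progression d (2 * d) (length l)
odd-multiples n (_ ∷ []) _ _ (s≤s ()) _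
odd-multiples n (_ ∷ _ ∷ []) _ _ (s≤s (s≤s ())) _
odd-multiples n (a ∷ b ∷ c ∷ l) inc@(a<b ∷ _) (0<a ∷ _) _ bound
  with d , refl ← m≤n⇒∃[o]m+o≡n (<⇒≤ a<b)
  with progression-or-bent a d (c ∷ l)
... | inj₂ bent = contradiction bent (bent-impossible (suc n) 0<a inc bound)
... | inj₁ eq   = a , 0<a , ≡.trans (cong (a ∷_) eq) (cong (λ t → progression a t (3 + length l)) d≡2a)
  where
  0<d : 0 ℕ.< d
  0<d = +-cancelˡ-< a 0 d (subst (ℕ._< a + d) (sym (+-identityʳ a)) a<b)
  d≡2a : d ≡ 2 * a
  d≡2a = difference-double n a d (length l) 0<a 0<d
    (subst (λ t → SizeBound (a ∷ t) (3 + n) (3 + length l)) eq bound)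

-- Passing between sorted lists of naturals and sets of integers

∈-progression⁺ : ∀ a d k i → i ℕ.< k → a + i * d ∈ progression a d k
∈-progression⁺ a d (suc k) zero    i<k       = here (+-identityʳ a)
∈-progression⁺ a d (suc k) (suc i) (s≤s i<k) =
  there (subst (_∈ progression (a + d) d k) (+-assoc a d (i * d)) (∈-progression⁺ (a + d) d k i i<k))

∈-progression⁻ : ∀ a d k {x} → x ∈ progression a d k → Σ ℕ λ i → i ℕ.< k × x ≡ a + i * d
∈-progression⁻ a d (suc k) (here refl) = 0 , s≤s z≤n , sym (+-identityʳ a)
∈-progression⁻ a d (suc k) (there x∈) with i , i<k , refl ← ∈-progression⁻ (a + d) d k x∈ =
  suc i , s≤s i<k , +-assoc a d (i * d)

map-+-∣∣ : ∀ {A} → All (λ a → + 0 < a) A → map +_ (map ∣_∣ A) ≡ A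
map-+-∣∣ [] = refl
map-+-∣∣ (+<+ _ ∷ pos) = cong₂ _∷_ refl (map-+-∣∣ pos)

theorem4 : (h : ℕ) → 3 ≤ h → (A : List ℤ) → Unique A → All (λ a → + 0 < a) A →
    3 ≤ length A →
    HasCard (InSignedSumset h A) ((2 * h * length A ∸ h) + 1) →
    Σ ℕ λ d → 1 ≤ d ×
    (∀ x → (x ∈ A) ⇔ (Σ ℕ λ i → (i Data.Nat.< length A) × (x ≡ + (d * (2 * i + 1)))))
theorem4 (suc (suc (suc n))) (s≤s (s≤s (s≤s z≤n))) A uniqA posA 3≤k (S , _ , memS , sizeS) =
  conclude (odd-multiples n l increasing positive (subst (3 ≤_) (sym length-l) 3≤k)
    (subst (SizeBound l h) (sym length-l) bound))
  where
  h = 3 + n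
  B = map ∣_∣ A
  l = sort B

  B≡A : map +_ B ≡ A
  B≡A = map-+-∣∣ posA

  length-l : length l ≡ length A
  length-l = ≡.trans (↭-length (sort-↭ B)) (length-map ∣_∣ A)

  uniqB : Unique B
  uniqB = Unique.map⁻ (subst Unique (sym B≡A) uniqA)

  increasing : Linked ℕ._<_ l
  increasing = Linked.zipWith (λ { (p , q) → ≤∧≢⇒< p q })
    (sort-↗ B , AllPairs⇒Linked (Unique-resp-↭ (↭⇒↭ₛ (↭-sym (sort-↭ B))) uniqB))

  positive : All (0 ℕ.<_) l
  positive = All-resp-↭ (↭-sym (sort-↭ B)) (All.map⁺ (All.map (λ { (+<+ p) → p }) posA))

  -- After the permutation and the absolute values are undone, sums over the sorted list lie in the
  -- signed sumset of `A`, hence in `S`, whose length is known.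
  bound : SizeBound l h (length A)
  bound xs uniq sums = subst (length xs ≤_) sizeS (unique-⊆⇒length≤ uniq λ x∈ →
    Equivalence.from (memS _) (subst (λ A → InSignedSumset h A _) B≡A
      (signedSum⇒InSignedSumset (signedSum-resp-↭ (sort-↭ B) (All.lookup sums x∈)))))

  value : ∀ d i → d + i * (2 * d) ≡ d * (2 * i + 1)
  value = solve-∀

  conclude : (Σ ℕ λ d → 1 ≤ d × l ≡ progression d (2 * d) (length l)) →
    Σ ℕ λ d → 1 ≤ d ×
    (∀ x → (x ∈ A) ⇔ (Σ ℕ λ i → (i Data.Nat.< length A) × (x ≡ + (d * (2 * i + 1)))))
  conclude (d , 1≤d , l≡prog) = d , 1≤d , λ x → mk⇔ to from
    where
    l≡ : l ≡ progression d (2 * d) (length A)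
    l≡ = ≡.trans l≡prog (cong (progression d (2 * d)) length-l)
    to : ∀ {x} → x ∈ A → Σ ℕ λ i → (i Data.Nat.< length A) × (x ≡ + (d * (2 * i + 1)))
    to {x} x∈A with y , y∈B , refl ← ∈-map⁻ +_ (subst (x ∈_) (sym B≡A) x∈A)
      with i , i<k , refl ← ∈-progression⁻ d (2 * d) (length A)
             (subst (y ∈_) l≡ (∈-resp-↭ (↭-sym (sort-↭ B)) y∈B)) =
      i , i<k , cong +_ (value d i)
    from : ∀ {x} → (Σ ℕ λ i → (i Data.Nat.< length A) × (x ≡ + (d * (2 * i + 1)))) → x ∈ A
    from (i , i<k , refl) = subst (_ ∈_) B≡A (∈-map⁺ +_ (∈-resp-↭ (sort-↭ B)
      (subst (_∈ l) (value d i) (subst (_ ∈_) (sym l≡) (∈-progression⁺ d (2 * d) (length A) i i<k)))))
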